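{- For every positive integer $k$, the set of $k$-critical $(P_5,\overline{P}_5)$-free graphs (up to isomorphism) is finite.
   Context: All graphs are finite and simple. A graph is $(P_5,\overline{P}_5)$-free if it contains no induced subgraph isomorphic to the path $P_5$ on five vertices or to its complement $\overline{P}_5$. A graph is $k$-critical if its chromatic number is $k$ and every proper induced subgraph is $(k-1)$-colorable. -}

module Defs where

open import Data.Nat using (ℕ; zero; suc; _<_; _∸_)
open import Data.Nat.Base using (_≡ᵇ_)
open import Data.Bool using (Bool; true; false; not; _∧_; _∨_)
open import Data.Fin using (Fin; toℕ; _≟_)
open import Data.Product using (Σ; _×_; _,_; ∃)
open import Data.List using (List)
open import Data.List.Relation.Unary.Any using (Any)
open import Relation.Binary.PropositionalEquality using (_≡_; _≢_)
open import Relation.Nullary using (¬_; does)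
open import Function.Definitions using (Injective)
open import Function.Bundles using (_↔_; Inverse)

record Graph (n : ℕ) : Set where
  field
    adj    : Fin n → Fin n → Bool
    sym    : ∀ i j → adj i j ≡ adj j i
    irrefl : ∀ i → adj i i ≡ false
open Graph public

complement : ∀ {n} → Graph n → Graph n
complement {n} G = record { adj = a ; sym = s ; irrefl = r }
  where
  a : Fin n → Fin n → Bool
  a i j = not (does (i ≟ j)) ∧ not (adj G i j)
  s : ∀ i j → a i j ≡ a j i
  s i j with i ≟ j | j ≟ i
  ... | Relation.Nullary.yes _ | Relation.Nullary.yes _ = Relation.Binary.PropositionalEquality.refl
  ... | Relation.Nullary.yes p | Relation.Nullary.no q = Data.Empty.⊥-elim (q (Relation.Binary.PropositionalEquality.sym p))
    where import Data.Empty
  ... | Relation.Nullary.no p | Relation.Nullary.yes q = Data.Empty.⊥-elim (p (Relation.Binary.PropositionalEquality.sym q))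
    where import Data.Empty
  ... | Relation.Nullary.no _ | Relation.Nullary.no _ =
    Relation.Binary.PropositionalEquality.cong not (sym G i j)
  r : ∀ i → a i i ≡ false
  r i with i ≟ i
  ... | Relation.Nullary.yes _ = Relation.Binary.PropositionalEquality.refl
  ... | Relation.Nullary.no p = Data.Empty.⊥-elim (p Relation.Binary.PropositionalEquality.refl)
    where import Data.Empty

P5 : Graph 5
P5 = record { adj = a ; sym = s ; irrefl = r }
  where
  a : Fin 5 → Fin 5 → Bool
  a i j = (suc (toℕ i) ≡ᵇ toℕ j) ∨ (suc (toℕ j) ≡ᵇ toℕ i)
  open import Data.Fin using (zero; suc)
  open Relation.Binary.PropositionalEquality using (refl)
  s : ∀ i j → a i j ≡ a j i
  s zero zero = refl
  s zero (suc zero) = refl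
  s zero (suc (suc zero)) = refl
  s zero (suc (suc (suc zero))) = refl
  s zero (suc (suc (suc (suc zero)))) = refl
  s (suc zero) zero = refl
  s (suc zero) (suc zero) = refl
  s (suc zero) (suc (suc zero)) = refl
  s (suc zero) (suc (suc (suc zero))) = refl
  s (suc zero) (suc (suc (suc (suc zero)))) = refl
  s (suc (suc zero)) zero = refl
  s (suc (suc zero)) (suc zero) = refl
  s (suc (suc zero)) (suc (suc zero)) = refl
  s (suc (suc zero)) (suc (suc (suc zero))) = refl
  s (suc (suc zero)) (suc (suc (suc (suc zero)))) = refl
  s (suc (suc (suc zero))) zero = refl
  s (suc (suc (suc zero))) (suc zero) = refl
  s (suc (suc (suc zero))) (suc (suc zero)) = refl
  s (suc (suc (suc zero))) (suc (suc (suc zero))) = refl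
  s (suc (suc (suc zero))) (suc (suc (suc (suc zero)))) = refl
  s (suc (suc (suc (suc zero)))) zero = refl
  s (suc (suc (suc (suc zero)))) (suc zero) = refl
  s (suc (suc (suc (suc zero)))) (suc (suc zero)) = refl
  s (suc (suc (suc (suc zero)))) (suc (suc (suc zero))) = refl
  s (suc (suc (suc (suc zero)))) (suc (suc (suc (suc zero)))) = refl
  r : ∀ i → a i i ≡ false
  r zero = refl
  r (suc zero) = refl
  r (suc (suc zero)) = refl
  r (suc (suc (suc zero))) = refl
  r (suc (suc (suc (suc zero)))) = refl

record InducedEmbedding {m n : ℕ} (H : Graph m) (G : Graph n) : Set where
  field
    f     : Fin m → Fin n
    inj   : Injective _≡_ _≡_ f
    preserves : ∀ i j → adj H i j ≡ adj G (f i) (f j)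

ContainsInduced : ∀ {n m} → Graph n → Graph m → Set
ContainsInduced G H = InducedEmbedding H G

P5coP5Free : ∀ {n} → Graph n → Set
P5coP5Free G = ¬ ContainsInduced G P5 × ¬ ContainsInduced G (complement P5)

Colorable : ∀ {n} → Graph n → ℕ → Set
Colorable {n} G k = Σ (Fin n → Fin k) λ c → ∀ i j → adj G i j ≡ true → c i ≢ c j

induced : ∀ {m n} → Graph n → (f : Fin m → Fin n) → Graph m
induced G f = record
  { adj = λ i j → adj G (f i) (f j)
  ; sym = λ i j → sym G (f i) (f j)
  ; irrefl = λ i → irrefl G (f i) }

HasChromaticNumber : ∀ {n} → Graph n → ℕ → Set
HasChromaticNumber G k = Colorable G k × (∀ j → j < k → ¬ Colorable G j)

Critical : ∀ {n} → ℕ → Graph n → Set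
Critical {n} k G =
  HasChromaticNumber G k ×
  (∀ m (f : Fin m → Fin n) → Injective _≡_ _≡_ f → m < n →
     Colorable (induced G f) (k ∸ 1))

record _≅_ {n m : ℕ} (G : Graph n) (H : Graph m) : Set where
  field
    bij : Fin n ↔ Fin m
    preserves : ∀ i j → adj G i j ≡ adj H (Inverse.to bij i) (Inverse.to bij j)

{-# OPTIONS --safe #-}

-- Weight the vertices of a fixed graph G; a weighted colouring uses w v colours
-- at v. Around an induced C5 of a (P5, co-P5)-free graph, every other vertex is
-- complete to the C5, anticomplete to it, or a twin of one of its vertices.
-- Hence the five twin classes and their union X are modules. A module of a
-- critical weighting is critical itself, so in a k-critical weighting with C5 in
-- its support either five modules of smaller chromatic number cover the support,
-- or X can be contracted to one vertex whose weight is the chromatic number of X.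
-- When no C5 is left, the support is perfect, so that a critical weighting is
-- supported on a clique. By induction on k, the sum of F (w v) is at most F k for
-- any superadditive F with 5 F (k - 1) ≤ F k; for w = 1 this bounds the order of G.
module Submission where

open import Defs
open import Data.Nat using (ℕ; _≤_)
open import Data.Product using (Σ; _,_; proj₁; proj₂)
open import Data.List using (List)
open import Data.List.Relation.Unary.Any using (Any)

open import Data.Nat hiding (ℕ; _≤_; _≟_)
open import Data.Nat.Properties renaming (_≟_ to _≟ℕ_)
open import Algebra.Properties.CommutativeMonoid.Sum +-0-commutativeMonoid
  using (sum; sum-remove; ∑-distrib-+)
open import Data.Bool using (Bool; true; false; not; _∧_; _∨_; if_then_else_)
import Data.Bool as Bool
open import Data.Bool.Properties using (∧-comm)
open import Data.Empty using (⊥; ⊥-elim)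
open import Data.Fin using (Fin; zero; suc; _≟_; punchIn; punchOut; toℕ; fromℕ<)
open import Data.Fin.Patterns using (0F; 1F; 2F; 3F; 4F)
open import Data.Fin.Properties using (any?; all?; punchInᵢ≢i; punchIn-punchOut;
  punchIn-injective; toℕ<n; toℕ-injective; toℕ-fromℕ<)
open import Data.List using ([]; _∷_; allFin; concatMap; filter; map; upTo)
open import Data.List.Extrema ≤-totalOrder using (argmax; argmax-all; f[xs]≤f[argmax])
open import Data.List.Membership.Propositional.Properties using (∈-filter⁺; ∈-allFin; ∈-upTo⁺)
open import Data.List.Relation.Unary.All as All using ()
open import Data.List.Relation.Unary.All.Properties using (all-filter)
open import Data.List.Relation.Unary.Any as Any using (here; there)
open import Data.List.Relation.Unary.Any.Properties using (concatMap⁺; map⁺)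
open import Data.Product using (_×_; ∃)
open import Data.Sum using (_⊎_; inj₁; inj₂)
open import Data.Vec using (Vec; []; _∷_; lookup)
open import Function using (_∘_; const; id)
open import Function.Construct.Identity using (↔-id)
open import Relation.Binary.PropositionalEquality as ≡ using (_≡_; _≢_; refl; cong; subst)
open import Relation.Nullary using (¬_; Dec; yes; no; does)
open import Relation.Nullary.Decidable
  using (_×-dec_; _→-dec_; ¬?; from-yes; decidable-stable; dec-true; dec-false)

-- Boolean connectives and tautologies checked by evaluation

∧-splitˡ : ∀ {a b} → a ∧ b ≡ true → a ≡ true
∧-splitˡ {true} _ = refl

∧-splitʳ : ∀ {a b} → a ∧ b ≡ true → b ≡ true
∧-splitʳ {true} b = b

∧-join : ∀ {a b} → a ≡ true → b ≡ true → a ∧ b ≡ true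
∧-join refl refl = refl

∨-split : ∀ {a b} → a ∨ b ≡ true → a ≡ true ⊎ b ≡ true
∨-split {true}  _ = inj₁ refl
∨-split {false} b = inj₂ b

∨-splitˡ : ∀ {a b} → a ∨ b ≡ false → a ≡ false
∨-splitˡ {false} _ = refl

∨-joinʳ : ∀ a {b} → b ≡ true → a ∨ b ≡ true
∨-joinʳ true  _ = refl
∨-joinʳ false b = b

true≢false : ∀ {b} → b ≡ true → b ≡ false → ⊥
true≢false refl ()

true? : ∀ b → b ≡ true ⊎ b ≡ false
true? true  = inj₁ refl
true? false = inj₂ refl

infixr 4 _⇒_
_⇒_ : Bool → Bool → Bool
a ⇒ b = not a ∨ b

⇒-elim : ∀ {a b} → (a ⇒ b) ≡ true → a ≡ true → b ≡ true
⇒-elim {true} h _ = h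

check : ∀ k → (Vec Bool k → Bool) → Bool
check zero    p = p []
check (suc k) p = check k (p ∘ (true ∷_)) ∧ check k (p ∘ (false ∷_))

-- For a closed `p` the premise evaluates, so `refl` proves a tautology by running through all
-- assignments.
check-sound : ∀ k p → check k p ≡ true → ∀ bs → p bs ≡ true
check-sound zero    p h []           = h
check-sound (suc k) p h (true  ∷ bs) = check-sound k _ (∧-splitˡ h) bs
check-sound (suc k) p h (false ∷ bs) =
  check-sound k _ (∧-splitʳ {check k (p ∘ (true ∷_))} h) bs

-- Vertex weights and their sums

mix : ∀ {n} {A : Set} → (Fin n → Bool) → (Fin n → A) → (Fin n → A) → Fin n → A
mix X z w v = if X v then z v else w v

⁅_⁆ : ∀ {n} → Fin n → Fin n → Bool
⁅ u ⁆ v = does (u ≟ v)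

∈⁅⁆ : ∀ {n} (u : Fin n) → ⁅ u ⁆ u ≡ true
∈⁅⁆ u = dec-true (u ≟ u) refl

∈⁅⁆⇒≡ : ∀ {n} (u : Fin n) {v} → ⁅ u ⁆ v ≡ true → u ≡ v
∈⁅⁆⇒≡ u {v} h with u ≟ v
... | yes u≡v = u≡v

infixl 6 _↾_ _∖_ _⊖_
infix 4 _≼_

_↾_ : ∀ {n} → (Fin n → ℕ) → (Fin n → Bool) → Fin n → ℕ
w ↾ X = mix X w (const 0)

_∖_ : ∀ {n} → (Fin n → ℕ) → (Fin n → Bool) → Fin n → ℕ
w ∖ X = mix X (const 0) w

-- Truncated subtraction lets a colour class contain vertices whose weight is already used up.
_⊖_ : ∀ {n} → (Fin n → ℕ) → (Fin n → Bool) → Fin n → ℕ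
w ⊖ T = mix T (pred ∘ w) w

_≼_ : ∀ {n} → (Fin n → ℕ) → (Fin n → ℕ) → Set
w ≼ w′ = ∀ v → w v ≤ w′ v

≼-refl : ∀ {n} {w : Fin n → ℕ} → w ≼ w
≼-refl _ = ≤-refl

≼-trans : ∀ {n} {u v w : Fin n → ℕ} → u ≼ v → v ≼ w → u ≼ w
≼-trans p q i = ≤-trans (p i) (q i)

↾-≼ : ∀ {n} (w : Fin n → ℕ) X → w ↾ X ≼ w
↾-≼ w X v with X v
... | true  = ≤-refl
... | false = z≤n

∖-≼ : ∀ {n} (w : Fin n → ℕ) X → w ∖ X ≼ w
∖-≼ w X v with X v
... | true  = z≤n
... | false = ≤-refl

⊖-≼ : ∀ {n} (w : Fin n → ℕ) T → w ⊖ T ≼ w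
⊖-≼ w T v with T v
... | true  = pred[n]≤n
... | false = ≤-refl

⊖-mono : ∀ {n} {w w′ : Fin n → ℕ} T → w ≼ w′ → w ⊖ T ≼ w′ ⊖ T
⊖-mono T p v with T v
... | true  = pred-mono-≤ (p v)
... | false = p v

⊖-comm : ∀ {n} (w : Fin n → ℕ) T T′ → w ⊖ T ⊖ T′ ≼ w ⊖ T′ ⊖ T
⊖-comm w T T′ v with T v | T′ v
... | true  | true  = ≤-refl
... | true  | false = ≤-refl
... | false | true  = ≤-refl
... | false | false = ≤-refl

mix-true : ∀ {n} {A : Set} {X : Fin n → Bool} {z w : Fin n → A} {v} →
  X v ≡ true → mix X z w v ≡ z v
mix-true p rewrite p = refl

mix-false : ∀ {n} {A : Set} {X : Fin n → Bool} {z w : Fin n → A} {v} →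
  X v ≡ false → mix X z w v ≡ w v
mix-false p rewrite p = refl

sum-mono : ∀ {n} {f g : Fin n → ℕ} → f ≼ g → sum f ≤ sum g
sum-mono {zero}  p = z≤n
sum-mono {suc n} p = +-mono-≤ (p zero) (sum-mono (p ∘ suc))

sum-step : ∀ {n} {f g : Fin n → ℕ} t → (∀ v → t ≢ v → f v ≤ g v) →
  f t ≤ suc (g t) → sum f ≤ suc (sum g)
sum-step {suc n} {f} {g} t p q = begin
  sum f                               ≡⟨ sum-remove f ⟩
  f t + sum (f ∘ punchIn t)           ≤⟨ +-mono-≤ q (sum-mono λ j → p (punchIn t j) (punchInᵢ≢i t j ∘ ≡.sym)) ⟩
  suc (g t + sum (g ∘ punchIn t))     ≡⟨ cong suc (sum-remove g) ⟨
  suc (sum g)                         ∎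
  where open ≤-Reasoning

sum-strict : ∀ {n} {f g : Fin n → ℕ} t → f ≼ g → f t < g t → sum f < sum g
sum-strict {suc n} {f} {g} t p q = begin-strict
  sum f                               ≡⟨ sum-remove f ⟩
  f t + sum (f ∘ punchIn t)           <⟨ +-mono-<-≤ q (sum-mono λ j → p (punchIn t j)) ⟩
  g t + sum (g ∘ punchIn t)           ≡⟨ sum-remove g ⟨
  sum g                               ∎
  where open ≤-Reasoning

term≤sum : ∀ {n} (f : Fin n → ℕ) t → f t ≤ sum f
term≤sum {suc n} f t = ≤-trans (m≤m+n _ _) (≤-reflexive (≡.sym (sum-remove f)))

supported? : ∀ {n} (w : Fin n → ℕ) → Dec (∃ λ v → 0 < w v)
supported? w = any? λ v → 0 <? w v

-- Weighted colourings, cliques and modules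

module _ {n} (G : Graph n) where

  Stable : (Fin n → Bool) → Set
  Stable T = ∀ u v → T u ≡ true → T v ≡ true → adj G u v ≡ false

  Clique : (Fin n → ℕ) → Set
  Clique z = ∀ u v → 0 < z u → 0 < z v → u ≢ v → adj G u v ≡ true

  -- r stable sets in which every vertex v occurs at least w v times.
  Col : ℕ → (Fin n → ℕ) → Set
  Col zero    w = ∀ v → w v ≤ 0
  Col (suc r) w = Σ (Fin n → Bool) λ T → Stable T × Col r (w ⊖ T)

  col-antitone : ∀ r {w w′} → w′ ≼ w → Col r w → Col r w′
  col-antitone zero    p c          v = ≤-trans (p v) (c v)
  col-antitone (suc r) p (T , s , c)  = T , s , col-antitone r (⊖-mono T p) c

  col-mono : ∀ {r s w} → r ≤ s → Col r w → Col s w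
  col-mono {s = zero}  z≤n     c           = c
  col-mono {s = suc s} z≤n     c           = const false , (λ _ _ ()) , col-mono {s = s} z≤n c
  col-mono             (s≤s p) (T , s , c) = T , s , col-mono p c

  -- Classes avoiding `m` leave its weight positive, so some class contains `m`; by `⊖-comm` it can
  -- be moved to the front.
  col-through : ∀ r {w} m → 0 < w m → Col (suc r) w →
    ∃ λ T → T m ≡ true × Stable T × Col r (w ⊖ T)
  col-through r {w} m pos (T , st , c) with true? (T m)
  ... | inj₁ t = T , t , st , c
  ... | inj₂ t = later r c
    where
    pos′ : 0 < (w ⊖ T) m
    pos′ = subst (0 <_) (≡.sym (mix-false {X = T} {z = pred ∘ w} {w = w} t)) pos
    later : ∀ r → Col r (w ⊖ T) → ∃ λ T′ → T′ m ≡ true × Stable T′ × Col r (w ⊖ T′)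
    later zero    c = ⊥-elim (<⇒≱ pos′ (c m))
    later (suc r) c with col-through r m pos′ c
    ... | T′ , t′ , st′ , c′ =
      T′ , t′ , st′ , T , st , col-antitone r (⊖-comm w T′ T) c′

  col-weight : ∀ r {w} v → Col r w → w v ≤ r
  col-weight zero        v c           = c v
  col-weight (suc r) {w} v (T , _ , c) with T v | col-weight r v c
  ... | true  | q = ≤-trans (suc-pred-≤ (w v)) (s≤s q)
    where
    suc-pred-≤ : ∀ k → k ≤ suc (pred k)
    suc-pred-≤ zero    = z≤n
    suc-pred-≤ (suc k) = ≤-refl
  ... | false | q = m≤n⇒m≤1+n q

  col-point : ∀ a c → Col a (const a ↾ ⁅ c ⁆)
  col-point zero    c v with ⁅ c ⁆ v
  ... | true  = z≤n
  ... | false = z≤n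
  col-point (suc a) c = ⁅ c ⁆ , stable , col-antitone a le (col-point a c)
    where
    stable : Stable ⁅ c ⁆
    stable u v p q with ∈⁅⁆⇒≡ c {u} p | ∈⁅⁆⇒≡ c {v} q
    ... | refl | refl = irrefl G c
    le : (const (suc a) ↾ ⁅ c ⁆) ⊖ ⁅ c ⁆ ≼ const a ↾ ⁅ c ⁆
    le v with ⁅ c ⁆ v
    ... | true  = ≤-refl
    ... | false = ≤-refl

  -- A stable set contains at most one vertex of a clique, so only one unit of weight can be lost.
  clique-meets-stable : ∀ {z T} → Clique z → Stable T → sum z ≤ suc (sum (z ⊖ T))
  clique-meets-stable {z} {T} cl st with any? (λ t → (0 <? z t) ×-dec (T t Bool.≟ true))
  ... | no none = m≤n⇒m≤1+n (sum-mono le)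
    where
    le : z ≼ z ⊖ T
    le v with T v in eq | z v in eqz
    ... | false | _     = ≤-refl
    ... | true  | zero  = z≤n
    ... | true  | suc k = ⊥-elim (none (v , subst (0 <_) (≡.sym eqz) (s≤s z≤n) , eq))
  ... | yes (t , pos , t∈T) = sum-step t away at
    where
    away : ∀ v → t ≢ v → z v ≤ (z ⊖ T) v
    away v t≢v with T v in eq | z v in eqz
    ... | false | _     = ≤-refl
    ... | true  | zero  = z≤n
    ... | true  | suc k =
      ⊥-elim (true≢false (cl t v pos (subst (0 <_) (≡.sym eqz) (s≤s z≤n)) t≢v) (st t v t∈T eq))
    at : z t ≤ suc ((z ⊖ T) t)
    at rewrite t∈T with z t
    ... | zero  = z≤n
    ... | suc k = ≤-refl

  clique-bound : ∀ r {w z} → Col r w → z ≼ w → Clique z → sum z ≤ r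
  clique-bound zero    {w} {z} c z≼w cl =
    ≤-trans (sum-mono {g = const 0} (≼-trans {v = w} z≼w c)) (≤-reflexive (sum-0 n))
    where
    sum-0 : ∀ n → sum {n} (const 0) ≡ 0
    sum-0 zero    = refl
    sum-0 (suc n) = sum-0 n
  clique-bound (suc r) {w} {z} (T , st , c) z≼w cl =
    ≤-trans (clique-meets-stable cl st)
      (s≤s (clique-bound r c (⊖-mono T z≼w)
        λ u v p q → cl u v (<-≤-trans p (⊖-≼ z T u)) (<-≤-trans q (⊖-≼ z T v))))

  Module : (Fin n → Bool) → Set
  Module X = ∀ u x y → X u ≡ false → X x ≡ true → X y ≡ true → adj G u x ≡ adj G u y

  -- d is the number of colour classes meeting the module X; inside X these
  -- classes may be replaced by any other d stable sets.
  recolour : ∀ {X} → Module X → ∀ r {w} → Col r w →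
    ∃ λ d → Col d (w ↾ X) × (∀ z → Col d z → Col r (mix X z w))
  recolour {X} mod zero {w} c = 0 , (λ v → ≤-trans (↾-≼ w X v) (c v)) , swap
    where
    swap : ∀ z → Col 0 z → Col 0 (mix X z w)
    swap z cz v with X v
    ... | true  = cz v
    ... | false = c v
  recolour {X} mod (suc r) {w} (T , st , c)
    with recolour mod r c | any? (λ x → (X x Bool.≟ true) ×-dec (T x Bool.≟ true))
  ... | d , inX , swap | yes (x , x∈X , x∈T) = suc d , (T , st , col-antitone d le inX) , swap′
    where
    le : (w ↾ X) ⊖ T ≼ (w ⊖ T) ↾ X
    le v with X v | T v
    ... | true  | true  = ≤-refl
    ... | true  | false = ≤-refl
    ... | false | true  = ≤-refl
    ... | false | false = ≤-refl
    swap′ : ∀ z → Col (suc d) z → Col (suc r) (mix X z w)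
    swap′ z (T′ , st′ , c′) = mix X T′ T , stable , col-antitone r le′ (swap _ c′)
      where
      le′ : mix X z w ⊖ mix X T′ T ≼ mix X (z ⊖ T′) (w ⊖ T)
      le′ v with X v | T v | T′ v
      ... | true  | _     | true  = ≤-refl
      ... | true  | _     | false = ≤-refl
      ... | false | true  | _     = ≤-refl
      ... | false | false | _     = ≤-refl
      stable : Stable (mix X T′ T)
      stable u v p q with X u in equ | X v in eqv
      ... | true  | true  = st′ u v p q
      ... | false | false = st u v p q
      -- Outside `X` the class is still `T`. Its vertices there miss `x`, hence the whole module, so
      -- any stable `T′` fits inside.
      ... | false | true  = ≡.trans (mod u v x equ eqv x∈X) (st u x p x∈T)
      ... | true  | false =
        ≡.trans (Graph.sym G u v) (≡.trans (mod v u x eqv equ x∈X) (st v x q x∈T))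
  ... | d , inX , swap | no disjoint = d , col-antitone d le inX , swap′
    where
    le : w ↾ X ≼ (w ⊖ T) ↾ X
    le v with X v in eqX | T v in eqT
    ... | true  | true  = ⊥-elim (disjoint (v , eqX , eqT))
    ... | true  | false = ≤-refl
    ... | false | _     = ≤-refl
    swap′ : ∀ z → Col d z → Col (suc r) (mix X z w)
    swap′ z c′ = T , st , col-antitone r le′ (swap z c′)
      where
      le′ : mix X z w ⊖ T ≼ mix X z (w ⊖ T)
      le′ v with X v in eqX | T v in eqT
      ... | true  | true  = ⊥-elim (disjoint (v , eqX , eqT))
      ... | true  | false = ≤-refl
      ... | false | true  = ≤-refl
      ... | false | false = ≤-refl

-- Induced patterns on five vertices

TwinFree : Graph 5 → Set
TwinFree H = ∀ i j → (∀ k → adj H i k ≡ adj H j k) → i ≡ j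

twinFree? : ∀ H → Dec (TwinFree H)
twinFree? H = all? λ i → all? λ j → all? (λ k → adj H i k Bool.≟ adj H j k) →-dec (i ≟ j)

module _ {n} (G : Graph n) where

  -- Injectivity is automatic, because a pattern without twins cannot have
  -- two vertices with the same image.
  embed : (H : Graph 5) → TwinFree H → (a b c d e : Fin n) →
    adj G a b ≡ adj H 0F 1F → adj G a c ≡ adj H 0F 2F → adj G a d ≡ adj H 0F 3F →
    adj G a e ≡ adj H 0F 4F → adj G b c ≡ adj H 1F 2F → adj G b d ≡ adj H 1F 3F →
    adj G b e ≡ adj H 1F 4F → adj G c d ≡ adj H 2F 3F → adj G c e ≡ adj H 2F 4F →
    adj G d e ≡ adj H 3F 4F → ContainsInduced G H
  embed H twinFree a b c d e ab ac ad ae bc bd be cd ce de = record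
    { f = f
    ; inj = λ {i} {j} fi≡fj → twinFree i j λ k →
        ≡.trans (pres i k) (≡.trans (cong (λ v → adj G v (f k)) fi≡fj) (≡.sym (pres j k)))
    ; preserves = pres }
    where
    f : Fin 5 → Fin n
    f = lookup (a ∷ b ∷ c ∷ d ∷ e ∷ [])
    loop : ∀ i → adj H i i ≡ adj G (f i) (f i)
    loop i = ≡.trans (Graph.irrefl H i) (≡.sym (Graph.irrefl G (f i)))
    flip : ∀ i j → adj H i j ≡ adj G (f i) (f j) → adj H j i ≡ adj G (f j) (f i)
    flip i j p = ≡.trans (Graph.sym H j i) (≡.trans p (Graph.sym G (f i) (f j)))
    pres : ∀ i j → adj H i j ≡ adj G (f i) (f j)
    pres 0F 1F = ≡.sym ab
    pres 0F 2F = ≡.sym ac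
    pres 0F 3F = ≡.sym ad
    pres 0F 4F = ≡.sym ae
    pres 1F 2F = ≡.sym bc
    pres 1F 3F = ≡.sym bd
    pres 1F 4F = ≡.sym be
    pres 2F 3F = ≡.sym cd
    pres 2F 4F = ≡.sym ce
    pres 3F 4F = ≡.sym de
    pres 0F 0F = loop 0F
    pres 1F 1F = loop 1F
    pres 2F 2F = loop 2F
    pres 3F 3F = loop 3F
    pres 4F 4F = loop 4F
    pres 1F 0F = flip 0F 1F (≡.sym ab)
    pres 2F 0F = flip 0F 2F (≡.sym ac)
    pres 3F 0F = flip 0F 3F (≡.sym ad)
    pres 4F 0F = flip 0F 4F (≡.sym ae)
    pres 2F 1F = flip 1F 2F (≡.sym bc)
    pres 3F 1F = flip 1F 3F (≡.sym bd)
    pres 4F 1F = flip 1F 4F (≡.sym be)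
    pres 3F 2F = flip 2F 3F (≡.sym cd)
    pres 4F 2F = flip 2F 4F (≡.sym ce)
    pres 4F 3F = flip 3F 4F (≡.sym de)

  adj-flip : ∀ {b} u v → adj G u v ≡ b → adj G v u ≡ b
  adj-flip u v p = ≡.trans (Graph.sym G v u) p

  module _ (free : P5coP5Free G) where

    no-P5 : ∀ {a b c d e} →
      adj G a b ≡ true → adj G b c ≡ true → adj G c d ≡ true → adj G d e ≡ true →
      adj G a c ≡ false → adj G a d ≡ false → adj G a e ≡ false →
      adj G b d ≡ false → adj G b e ≡ false → adj G c e ≡ false → ⊥
    no-P5 ab bc cd de ac ad ae bd be ce = proj₁ free
      (embed P5 (from-yes (twinFree? P5)) _ _ _ _ _ ab ac ad ae bc bd be cd ce de)

    no-coP5 : ∀ {a b c d e} →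
      adj G a b ≡ false → adj G b c ≡ false → adj G c d ≡ false → adj G d e ≡ false →
      adj G a c ≡ true → adj G a d ≡ true → adj G a e ≡ true →
      adj G b d ≡ true → adj G b e ≡ true → adj G c e ≡ true → ⊥
    no-coP5 ab bc cd de ac ad ae bd be ce = proj₂ free
      (embed (complement P5) (from-yes (twinFree? (complement P5)))
        _ _ _ _ _ ab ac ad ae bc bd be cd ce de)

  record C5 (a b c d e : Fin n) : Set where
    field
      ab : adj G a b ≡ true
      bc : adj G b c ≡ true
      cd : adj G c d ≡ true
      de : adj G d e ≡ true
      ea : adj G e a ≡ true
      ac : adj G a c ≡ false
      bd : adj G b d ≡ false
      ce : adj G c e ≡ false
      da : adj G d a ≡ false
      eb : adj G e b ≡ false

  rotate : ∀ {a b c d e} → C5 a b c d e → C5 b c d e a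
  rotate h = record
    { ab = bc ; bc = cd ; cd = de ; de = ea ; ea = ab
    ; ac = bd ; bd = ce ; ce = da ; da = eb ; eb = ac }
    where open C5 h

-- Adjacencies to an induced C5, twin classes and their hull

infix 5 _≡ᴮ_
_≡ᴮ_ : Bool → Bool → Bool
true  ≡ᴮ b = b
false ≡ᴮ b = not b

≡ᴮ-sound : ∀ {a b} → (a ≡ᴮ b) ≡ true → a ≡ b
≡ᴮ-sound {true}  {true}  _ = refl
≡ᴮ-sound {false} {false} _ = refl

-- The possible adjacencies of a vertex to the successive vertices of an
-- induced P4, respectively C5, when there is no induced P5 or house.
okP4 : Bool → Bool → Bool → Bool → Bool
okP4 p q r s = (p ∧ s ⇒ q ≡ᴮ r) ∧ (p ∧ not s ⇒ q ∨ r) ∧ (s ∧ not p ⇒ q ∨ r)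

okC5 : Vec Bool 5 → Bool
okC5 (a ∷ b ∷ c ∷ d ∷ e ∷ []) =
  okP4 a b c d ∧ okP4 b c d e ∧ okP4 c d e a ∧ okP4 d e a b ∧ okP4 e a b c

twin : Bool → Bool → Bool → Bool → Bool
twin b c d e = (b ∧ e) ∧ not c ∧ not d

-- Only the pattern of a twin on the last four vertices leaves the first entry open. Evaluation
-- covers the 64 cases.
ok-differ : ∀ a a′ b c d e → twin b c d e ≡ false →
  okC5 (a ∷ b ∷ c ∷ d ∷ e ∷ []) ≡ true → okC5 (a′ ∷ b ∷ c ∷ d ∷ e ∷ []) ≡ true → a ≡ a′
ok-differ a a′ b c d e t p q =
  ≡ᴮ-sound (⇒-elim (⇒-elim (⇒-elim taut (cong not t)) p) q)
  where
  taut = check-sound 6 (λ { (a ∷ a′ ∷ b ∷ c ∷ d ∷ e ∷ []) → not (twin b c d e) ⇒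
      okC5 (a ∷ b ∷ c ∷ d ∷ e ∷ []) ⇒ okC5 (a′ ∷ b ∷ c ∷ d ∷ e ∷ []) ⇒ (a ≡ᴮ a′) })
    refl (a ∷ a′ ∷ b ∷ c ∷ d ∷ e ∷ [])

anyTwin : Bool → Bool → Bool → Bool → Bool → Bool
anyTwin a b c d e =
  twin b c d e ∨ twin c d e a ∨ twin d e a b ∨ twin e a b c ∨ twin a b c d

-- Apart from twins, only complete and anticomplete vertices remain. One consecutive pair is
-- compared here; rotations supply the others.
ok-constant : ∀ a b c d e → anyTwin a b c d e ≡ false →
  okC5 (a ∷ b ∷ c ∷ d ∷ e ∷ []) ≡ true → a ≡ b
ok-constant a b c d e t p = ≡ᴮ-sound (⇒-elim (⇒-elim taut (cong not t)) p)
  where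
  taut = check-sound 5 (λ { (a ∷ b ∷ c ∷ d ∷ e ∷ []) → not (anyTwin a b c d e) ⇒
      okC5 (a ∷ b ∷ c ∷ d ∷ e ∷ []) ⇒ (a ≡ᴮ b) })
    refl (a ∷ b ∷ c ∷ d ∷ e ∷ [])

module _ {n} (G : Graph n) (free : P5coP5Free G) where

  -- There are four excluded cases. If `u` sees exactly one vertex of the path, an end, it prolongs
  -- the path to an induced P5; if it sees both ends and exactly one inner vertex, it completes a
  -- house.
  allowedP4 : ∀ u {p q r s} →
    adj G p q ≡ true → adj G q r ≡ true → adj G r s ≡ true →
    adj G p r ≡ false → adj G p s ≡ false → adj G q s ≡ false →
    okP4 (adj G u p) (adj G u q) (adj G u r) (adj G u s) ≡ true
  allowedP4 u {p} {q} {r} {s} pq qr rs pr ps qs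
    with adj G u p in up | adj G u q in uq | adj G u r in ur | adj G u s in us
  ... | true  | true  | true  | true  = refl
  ... | true  | true  | true  | false = refl
  ... | true  | true  | false | true  = ⊥-elim (no-coP5 G free
    qs (adj-flip G p s ps) pr (adj-flip G u r ur) (adj-flip G p q pq) qr (adj-flip G u q uq)
    (adj-flip G r s rs) (adj-flip G u s us) (adj-flip G u p up))
  ... | true  | true  | false | false = refl
  ... | true  | false | true  | true  = ⊥-elim (no-coP5 G free
    uq qs (adj-flip G p s ps) pr us up ur (adj-flip G p q pq) qr (adj-flip G r s rs))
  ... | true  | false | true  | false = refl
  ... | true  | false | false | true  = refl
  ... | true  | false | false | false = ⊥-elim (no-P5 G free up pq qr rs uq ur us pr ps qs)
  ... | false | true  | true  | true  = refl
  ... | false | true  | true  | false = refl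
  ... | false | true  | false | true  = refl
  ... | false | true  | false | false = refl
  ... | false | false | true  | true  = refl
  ... | false | false | true  | false = refl
  ... | false | false | false | true  = ⊥-elim (no-P5 G free
    us (adj-flip G r s rs) (adj-flip G q r qr) (adj-flip G p q pq) ur uq up
    (adj-flip G q s qs) (adj-flip G p s ps) (adj-flip G p r pr))
  ... | false | false | false | false = refl

  allowedC5 : ∀ u {a b c d e} → C5 G a b c d e →
    okC5 (adj G u a ∷ adj G u b ∷ adj G u c ∷ adj G u d ∷ adj G u e ∷ []) ≡ true
  allowedC5 u h = ∧-join (path h) (∧-join (path h₁) (∧-join (path h₂)
    (∧-join (path h₃) (path h₄))))
    where
    h₁ = rotate G h
    h₂ = rotate G h₁
    h₃ = rotate G h₂
    h₄ = rotate G h₃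
    path : ∀ {a b c d e} → C5 G a b c d e →
      okP4 (adj G u a) (adj G u b) (adj G u c) (adj G u d) ≡ true
    path h = allowedP4 u ab bc cd ac (adj-flip G _ _ da) bd
      where open C5 h

  -- The vertices that can replace a in the 5-cycle a b c d e.
  twins : (b c d e : Fin n) → Fin n → Bool
  twins b c d e u = twin (adj G u b) (adj G u c) (adj G u d) (adj G u e)

  self-twin : ∀ {a b c d e} → C5 G a b c d e → twins b c d e a ≡ true
  self-twin {a} {b} {c} {d} {e} h
    rewrite C5.ab h | adj-flip G e a (C5.ea h) | C5.ac h | adj-flip G d a (C5.da h) = refl

  replace : ∀ {a b c d e} → C5 G a b c d e → ∀ x → twins b c d e x ≡ true → C5 G x b c d e
  replace {a} {b} {c} {d} {e} h x t = record
    { ab = ∧-splitˡ (∧-splitˡ t) ; bc = bc ; cd = cd ; de = de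
    ; ea = adj-flip G x e (∧-splitʳ {adj G x b} (∧-splitˡ t))
    ; ac = not-true (∧-splitˡ xcd) ; bd = bd ; ce = ce
    ; da = adj-flip G x d (not-true (∧-splitʳ {not (adj G x c)} xcd)) ; eb = eb }
    where
    open C5 h
    xcd = ∧-splitʳ {adj G x b ∧ adj G x e} t
    not-true : ∀ {b} → not b ≡ true → b ≡ false
    not-true {false} _ = refl

  -- Replacing `a` by `x` gives another C5, so `u` has two permitted patterns that can differ only
  -- in the first entry.
  twins-adj : ∀ {a b c d e} → C5 G a b c d e → ∀ u x →
    twins b c d e u ≡ false → twins b c d e x ≡ true → adj G u x ≡ adj G u a
  twins-adj {a} {b} {c} {d} {e} h u x u∉ x∈ =
    ok-differ _ _ (adj G u b) (adj G u c) (adj G u d) (adj G u e) u∉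
      (allowedC5 u (replace h x x∈)) (allowedC5 u h)

  twins-module : ∀ {a b c d e} → C5 G a b c d e → Module G (twins b c d e)
  twins-module h u x y u∉ x∈ y∈ =
    ≡.trans (twins-adj h u x u∉ x∈) (≡.sym (twins-adj h u y u∉ y∈))

  hull : (a b c d e : Fin n) → Fin n → Bool
  hull a b c d e u = anyTwin (adj G u a) (adj G u b) (adj G u c) (adj G u d) (adj G u e)

  hull-split : ∀ {a b c d e} u → hull a b c d e u ≡ true →
    twins b c d e u ≡ true ⊎ twins c d e a u ≡ true ⊎ twins d e a b u ≡ true ⊎
    twins e a b c u ≡ true ⊎ twins a b c d u ≡ true
  hull-split u p with ∨-split p
  ... | inj₁ q = inj₁ q
  ... | inj₂ p with ∨-split p
  ... | inj₁ q = inj₂ (inj₁ q)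
  ... | inj₂ p with ∨-split p
  ... | inj₁ q = inj₂ (inj₂ (inj₁ q))
  ... | inj₂ p with ∨-split p
  ... | inj₁ q = inj₂ (inj₂ (inj₂ (inj₁ q)))
  ... | inj₂ q = inj₂ (inj₂ (inj₂ (inj₂ q)))

  hull-rotate : ∀ {a b c d e} u → hull a b c d e u ≡ false → hull b c d e a u ≡ false
  hull-rotate {a} {b} {c} {d} {e} u p
    with twins b c d e u | twins c d e a u | twins d e a b u | twins e a b c u | twins a b c d u
  ... | false | false | false | false | false = refl

  -- A vertex outside the hull is no twin, so it treats the five cycle vertices alike; by
  -- `twins-adj` it treats every twin like the cycle vertex it replaces.
  hull-module : ∀ {a b c d e} → C5 G a b c d e → Module G (hull a b c d e)
  hull-module {a} {b} {c} {d} {e} h u x y u∉ x∈ y∈ = ≡.trans (toward-a x x∈) (≡.sym (toward-a y y∈))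
    where
    next : ∀ {a b c d e} → C5 G a b c d e → hull a b c d e u ≡ false → adj G u a ≡ adj G u b
    next h p = ok-constant _ _ _ _ _ p (allowedC5 u h)
    h₁ = rotate G h
    h₂ = rotate G h₁
    h₃ = rotate G h₂
    h₄ = rotate G h₃
    p₁ = hull-rotate {a} {b} {c} {d} {e} u u∉
    p₂ = hull-rotate {b} {c} {d} {e} {a} u p₁
    p₃ = hull-rotate {c} {d} {e} {a} {b} u p₂
    p₄ = hull-rotate {d} {e} {a} {b} {c} u p₃
    eb = next h₄ p₄
    de = ≡.trans (next h₃ p₃) eb
    cd = ≡.trans (next h₂ p₂) de
    bc = ≡.trans (next h₁ p₁) cd
    toward-a : ∀ x → hull a b c d e x ≡ true → adj G u x ≡ adj G u a
    toward-a x p with hull-split {a} {b} {c} {d} {e} x p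
    ... | inj₁ t = twins-adj h u x (∨-splitˡ u∉) t
    ... | inj₂ (inj₁ t) = ≡.trans (twins-adj h₁ u x (∨-splitˡ p₁) t) bc
    ... | inj₂ (inj₂ (inj₁ t)) = ≡.trans (twins-adj h₂ u x (∨-splitˡ p₂) t) cd
    ... | inj₂ (inj₂ (inj₂ (inj₁ t))) = ≡.trans (twins-adj h₃ u x (∨-splitˡ p₃) t) de
    ... | inj₂ (inj₂ (inj₂ (inj₂ t))) = ≡.trans (twins-adj h₄ u x (∨-splitˡ p₄) t) eb

-- Maximal elements and closures

maximizer : ∀ {n} {P : Fin n → Set} → (∀ u → Dec (P u)) → (f : Fin n → ℕ) → ∃ P →
  ∃ λ m → P m × (∀ u → P u → f u ≤ f m)
maximizer {n} P? f (u₀ , p₀) =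
  argmax f u₀ candidates ,
  argmax-all f p₀ (all-filter P? (allFin n)) ,
  λ u p → All.lookup (f[xs]≤f[argmax] u₀ candidates) (∈-filter⁺ P? (∈-allFin u) p)
  where candidates = filter P? (allFin n)

-- Inserting one vertex at a time; the fuel bounds the number of vertices outside M.
module _ {n} {Inv : Fin n → Set} {E : Fin n → Fin n → Set}
  (E? : ∀ x y → Dec (E x y)) (extend : ∀ {x y} → Inv x → E x y → Inv y) where

  private
    Closed : (Fin n → Bool) → Set
    Closed M = ∀ x y → M x ≡ true → E x y → M y ≡ true

    outside : (Fin n → Bool) → Fin n → ℕ
    outside M v = if M v then 0 else 1

  closure : ∀ fuel M → sum (outside M) ≤ fuel → (∀ x → M x ≡ true → Inv x) →
    Σ (Fin n → Bool) λ M′ → (∀ x → M x ≡ true → M′ x ≡ true) ×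
      (∀ x → M′ x ≡ true → Inv x) × Closed M′
  closure fuel M le inv
    with any? (λ x → any? (λ y → (M x Bool.≟ true) ×-dec (M y Bool.≟ false) ×-dec E? x y))
  ... | no none = M , (λ _ → id) , inv , closed
    where
    closed : Closed M
    closed x y x∈M xy with true? (M y)
    ... | inj₁ y∈M = y∈M
    ... | inj₂ y∉M = ⊥-elim (none (x , y , x∈M , y∉M , xy))
  ... | yes (x , y , x∈M , y∉M , xy) = step fuel le
    where
    M⁺ : Fin n → Bool
    M⁺ v = ⁅ y ⁆ v ∨ M v
    inv⁺ : ∀ v → M⁺ v ≡ true → Inv v
    inv⁺ v p with ∨-split p
    ... | inj₂ v∈M = inv v v∈M
    ... | inj₁ v∈y with ∈⁅⁆⇒≡ y {v} v∈y
    ... | refl = extend (inv x x∈M) xy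
    shrink : outside M⁺ ≼ outside M
    shrink v with ⁅ y ⁆ v | M v
    ... | true  | _     = z≤n
    ... | false | true  = z≤n
    ... | false | false = ≤-refl
    strict : outside M⁺ y < outside M y
    strict rewrite ∈⁅⁆ y | y∉M = s≤s z≤n
    step : ∀ fuel → sum (outside M) ≤ fuel → _
    step zero       le = ⊥-elim (<⇒≱ (sum-strict y shrink strict) (≤-trans le z≤n))
    step (suc fuel) le
      with closure fuel M⁺ (≤-pred (<-≤-trans (sum-strict y shrink strict) le)) inv⁺
    ... | M′ , sub , inv′ , closed = M′ , (λ v v∈M → sub v (∨-joinʳ (⁅ y ⁆ v) v∈M)) , inv′ , closed

-- Perfection of weightings without C5 in the support

module _ {n} (G : Graph n) (free : P5coP5Free G) where

  private
    V = Fin n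

  C5Free : (V → ℕ) → Set
  C5Free w = ∀ a b c d e →
    0 < w a → 0 < w b → 0 < w c → 0 < w d → 0 < w e → ¬ C5 G a b c d e

  CliqueBound : ℕ → (V → ℕ) → Set
  CliqueBound r w = ∀ z → z ≼ w → Clique G z → sum z ≤ r

  module Separation (w : V → ℕ) (c5free : C5Free w) (v : V) where

    Far : V → Set
    Far u = 0 < w u × u ≢ v × adj G v u ≡ false

    far? : ∀ u → Dec (Far u)
    far? u = (0 <? w u) ×-dec ¬? (u ≟ v) ×-dec (adj G v u Bool.≟ false)

    common : V → V → Bool
    common u s = adj G v s ∧ adj G u s

    module Component (pos : 0 < w v) (m : V) (far-m : Far m)
      (maximal : ∀ u → Far u → sum (w ↾ common u) ≤ sum (w ↾ common m)) where

      data Walk : ℕ → V → Set where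
        here : Walk zero m
        step : ∀ {t x y} → Far y → adj G x y ≡ true → Walk t y → Walk (suc t) x

      -- A common neighbour `s` of `v` and `m` in the support that misses `z` yields a house if it
      -- sees `y`, and the C5 `v y z m s` otherwise. So `z` sees all of them and also `y`,
      -- contradicting the choice of `m`.
      no-detour : ∀ {y z} → 0 < w y → adj G v y ≡ true → adj G m y ≡ false →
        Far z → adj G y z ≡ true → adj G z m ≡ true → ⊥
      no-detour {y} {z} wy vy my far-z yz zm =
        <⇒≱ (sum-strict y more strict) (maximal z far-z)
        where
        more : w ↾ common m ≼ w ↾ common z
        more s with adj G v s in vs | adj G m s in ms | adj G z s in zs
        ... | false | _     | _     = z≤n
        ... | true  | false | _     = z≤n
        ... | true  | true  | true  = ≤-refl
        ... | true  | true  | false with w s in ws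
        ... | zero  = z≤n
        ... | suc _ with true? (adj G y s)
        ... | inj₁ ys = ⊥-elim (no-coP5 G free
                (adj-flip G m y my) (adj-flip G v m (proj₂ (proj₂ far-m)))
                (proj₂ (proj₂ far-z)) zs (adj-flip G v y vy) yz ys (adj-flip G z m zm) ms vs)
        ... | inj₂ ys = ⊥-elim (c5free v y z m s pos wy (proj₁ far-z) (proj₁ far-m)
                (subst (0 <_) (≡.sym ws) (s≤s z≤n))
                record { ab = vy ; bc = yz ; cd = zm ; de = ms ; ea = adj-flip G v s vs
                       ; ac = proj₂ (proj₂ far-z) ; bd = adj-flip G m y my ; ce = zs
                       ; da = adj-flip G v m (proj₂ (proj₂ far-m)) ; eb = adj-flip G y s ys })
        strict : (w ↾ common m) y < (w ↾ common z) y
        strict rewrite vy | my | adj-flip G y z yz = wy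

      -- A shortest path from v through y to m has length at most three,
      -- as otherwise it contains an induced P5.
      near : ∀ fuel {t y x} → t ≤ fuel → 0 < w y → adj G v y ≡ true →
        Far x → adj G y x ≡ true → Walk t x → adj G m y ≡ true
      near fuel {y = y} le wy vy far-x yx here = adj-flip G y m yx
      near fuel {y = y} le wy vy far-x yx (step far-m xm here) with true? (adj G m y)
      ... | inj₁ my = my
      ... | inj₂ my = ⊥-elim (no-detour wy vy my far-x yx xm)
      near (suc fuel) {y = y} {x} (s≤s le) wy vy far-x yx
        (step {y = x₁} far-x₁ xx₁ walk@(step {y = x₂} far-x₂ x₁x₂ walk₂))
        with true? (adj G y x₁) | true? (adj G y x₂) | true? (adj G x x₂)
      ... | inj₁ yx₁ | _ | _ = near fuel le wy vy far-x₁ yx₁ walk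
      ... | inj₂ _ | inj₁ yx₂ | _ = near fuel (<⇒≤ le) wy vy far-x₂ yx₂ walk₂
      ... | inj₂ _ | inj₂ _ | inj₁ xx₂ = near fuel le wy vy far-x yx (step far-x₂ xx₂ walk₂)
      ... | inj₂ yx₁ | inj₂ yx₂ | inj₂ xx₂ = ⊥-elim (no-P5 G free vy yx xx₁ x₁x₂
        (proj₂ (proj₂ far-x)) (proj₂ (proj₂ far-x₁)) (proj₂ (proj₂ far-x₂)) yx₁ yx₂ xx₂)

      private
        Reachable : V → Set
        Reachable x = Far x × ∃ λ t → Walk t x

        component : Σ (V → Bool) λ M → (∀ x → ⁅ m ⁆ x ≡ true → M x ≡ true) ×
          (∀ x → M x ≡ true → Reachable x) ×
          (∀ x y → M x ≡ true → adj G x y ≡ true × Far y → M y ≡ true)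
        component = closure (λ x y → (adj G x y Bool.≟ true) ×-dec far? y)
          (λ { {x} {y} (far-x , t , walk) (xy , far-y) →
            far-y , suc t , step far-x (adj-flip G x y xy) walk })
          _ ⁅ m ⁆ ≤-refl start
          where
          start : ∀ x → ⁅ m ⁆ x ≡ true → Reachable x
          start x p with ∈⁅⁆⇒≡ m {x} p
          ... | refl = far-m , 0 , here

      M : V → Bool
      M = proj₁ component

      m∈M : M m ≡ true
      m∈M = proj₁ (proj₂ component) m (∈⁅⁆ m)

      M-far : ∀ {x} → M x ≡ true → Far x
      M-far {x} x∈M = proj₁ (proj₁ (proj₂ (proj₂ component)) x x∈M)

      -- `M` is closed under far neighbours, so `y` must be a neighbour of `v`; the walk from `x` to
      -- `m` then lets `near` apply.
      boundary : ∀ {x y} → M x ≡ true → M y ≡ false → 0 < w y → adj G x y ≡ true →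
        adj G v y ≡ true × adj G m y ≡ true
      boundary {x} {y} x∈M y∉M wy xy with true? (adj G v y)
      ... | inj₁ vy = vy , near _ ≤-refl wy vy (proj₁ reach) (adj-flip G x y xy) (proj₂ (proj₂ reach))
        where reach = proj₁ (proj₂ (proj₂ component)) x x∈M
      ... | inj₂ vy = ⊥-elim (true≢false (proj₂ (proj₂ (proj₂ component)) x y x∈M (xy , wy , y≢v , vy)) y∉M)
        where
        y≢v : y ≢ v
        y≢v refl = true≢false xy (adj-flip G y x (proj₂ (proj₂ (M-far x∈M))))

  -- A stable set whose removal lowers the weight of every clique of weight suc r.
  Hitting : ℕ → (V → ℕ) → Set
  Hitting r w = Σ (V → Bool) λ T → Stable G T × (∃ λ t → T t ≡ true × 0 < w t) × CliqueBound r (w ⊖ T)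

  -- Any clique below the reduced weighting stays a clique below `w` when its weight at `v` is
  -- raised by one.
  hit-universal : ∀ {r w} v → 0 < w v → (∀ u → 0 < w u → u ≢ v → adj G v u ≡ true) →
    CliqueBound (suc r) w → Hitting r w
  hit-universal {r} {w} v pos univ bound = ⁅ v ⁆ , stable , (v , ∈⁅⁆ v , pos) , bound′
    where
    stable : Stable G ⁅ v ⁆
    stable x y p q with ∈⁅⁆⇒≡ v {x} p | ∈⁅⁆⇒≡ v {y} q
    ... | refl | refl = irrefl G v
    bound′ : CliqueBound r (w ⊖ ⁅ v ⁆)
    bound′ z z≼ cl = ≤-pred (<-≤-trans (sum-strict v grow strict) (bound z⁺ z⁺≼w clique⁺))
      where
      z⁺ : V → ℕ
      z⁺ = mix ⁅ v ⁆ (suc ∘ z) z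
      grow : z ≼ z⁺
      grow x with ⁅ v ⁆ x
      ... | true  = n≤1+n _
      ... | false = ≤-refl
      strict : z v < z⁺ v
      strict rewrite ∈⁅⁆ v = ≤-refl
      z≼w : z ≼ w
      z≼w = ≼-trans z≼ (⊖-≼ w ⁅ v ⁆)
      z⁺≼w : z⁺ ≼ w
      z⁺≼w x with v ≟ x | z≼ x
      ... | yes refl | p = ≤-trans (s≤s p) (≤-reflexive (suc-pred (w v) {{>-nonZero pos}}))
      ... | no  _    | p = p
      clique⁺ : Clique G z⁺
      clique⁺ x y px py x≢y with v ≟ x | v ≟ y
      ... | yes refl | yes refl = ⊥-elim (x≢y refl)
      ... | yes refl | no  _    = univ y (<-≤-trans py (z≼w y)) (x≢y ∘ ≡.sym)
      ... | no  _    | yes refl = adj-flip G v x (univ x (<-≤-trans px (z≼w x)) x≢y)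
      ... | no  _    | no  _    = cl x y px py x≢y


  -- The common neighbours of v and m separate m from v, so a colour class through
  -- m on the side M of m and one through v on the other side form a stable set.
  record Separator (w : V → ℕ) (v m : V) : Set where
    field
      M        : V → Bool
      v∉M      : M v ≡ false
      m∈M      : M m ≡ true
      boundary : ∀ x y → M x ≡ true → M y ≡ false → 0 < w y → adj G x y ≡ true →
        adj G v y ≡ true × adj G m y ≡ true
    side : V → Bool
    side x = M x ∨ (adj G v x ∧ adj G m x)

  -- Among the non-neighbours of `v` in the support, `m` has the heaviest common neighbourhood with
  -- `v`; `M` is the component of `m` among these non-neighbours.
  separator : ∀ {w} → C5Free w → ∀ v → 0 < w v → (∃ λ u → 0 < w u × u ≢ v × adj G v u ≡ false) →
    ∃ λ m → 0 < w m × Separator w v m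
  separator {w} c5free v pos far
    with maximizer (Separation.far? w c5free v) (λ u → sum (w ↾ Separation.common w c5free v u)) far
  ... | m , far-m , maximal = m , proj₁ far-m , record
    { M = M ; v∉M = v∉M ; m∈M = m∈M ; boundary = λ x y → boundary }
    where
    open Separation.Component w c5free v pos m far-m maximal
    v∉M : M v ≡ false
    v∉M with true? (M v)
    ... | inj₁ p = ⊥-elim (proj₁ (proj₂ (M-far p)) refl)
    ... | inj₂ p = p

  module Gluing {r w v m} (pos : 0 < w v) (sep : Separator w v m)
    {T₁} (m∈T₁ : T₁ m ≡ true) (st₁ : Stable G T₁) (c₁ : Col G r (w ↾ Separator.side sep ⊖ T₁))
    {T₂} (v∈T₂ : T₂ v ≡ true) (st₂ : Stable G T₂) (c₂ : Col G r (w ∖ Separator.M sep ⊖ T₂)) where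

    open Separator sep

    T : V → Bool
    -- `boundary` controls edges only towards vertices of positive weight, so the glued set is cut
    -- down to the support.
    T x = (0 <ᵇ w x) ∧ mix M T₁ T₂ x

    T-pos : ∀ x → T x ≡ true → 0 < w x
    T-pos x p with w x
    ... | suc _ = s≤s z≤n

    T-mix : ∀ x → T x ≡ true → mix M T₁ T₂ x ≡ true
    T-mix x p = ∧-splitʳ {0 <ᵇ w x} p

    v∈T : T v ≡ true
    v∈T = ∧-join (dec-true (0 <? w v) pos) v∈mix
      where
      v∈mix : mix M T₁ T₂ v ≡ true
      v∈mix rewrite v∉M = v∈T₂

    -- An edge would make `y` a neighbour of `v`, yet both lie in the stable set `T₂`.
    across : ∀ x y → M x ≡ true → M y ≡ false → T y ≡ true → adj G x y ≡ false
    across x y x∈M y∉M y∈T with true? (adj G x y)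
    ... | inj₂ xy = xy
    ... | inj₁ xy = ⊥-elim (true≢false
      (proj₁ (boundary x y x∈M y∉M (T-pos y y∈T) xy))
      (st₂ v y v∈T₂ (≡.trans (≡.sym (mix-false {X = M} {z = T₁} {w = T₂} y∉M)) (T-mix y y∈T))))

    stable : Stable G T
    stable x y p q with M x in x∈ | M y in y∈ | T-mix x p | T-mix y q
    ... | true  | true  | p′ | q′ = st₁ x y p′ q′
    ... | false | false | p′ | q′ = st₂ x y p′ q′
    ... | true  | false | _  | _  = across x y x∈ y∈ q
    ... | false | true  | _  | _  = adj-flip G y x (across y x y∈ x∈ p)

    lower : ∀ x → (w ⊖ T) x ≤ (w ⊖ mix M T₁ T₂) x
    lower x with w x | mix M T₁ T₂ x
    ... | zero  | _     = z≤n
    ... | suc _ | true  = ≤-refl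
    ... | suc _ | false = ≤-refl

    -- A clique meeting `M` leaves it only through common neighbours of `v` and `m`, so it lies in
    -- `side`; any other clique avoids `M`. Either part is `r`-colourable once its class is removed.
    bound : CliqueBound r (w ⊖ T)
    bound z z≼ cl with any? (λ x → (0 <? z x) ×-dec (M x Bool.≟ true))
    ... | no none = clique-bound G r c₂ le cl
      where
      le : z ≼ w ∖ M ⊖ T₂
      le x with M x in eq | ≤-trans (z≼ x) (lower x)
      ... | true  | _ = ≤-trans (≮⇒≥ λ p → none (x , p , eq)) z≤n
      ... | false | p = p
    ... | yes (x₀ , px₀ , x₀∈M) = clique-bound G r c₁ le cl
      where
      le : z ≼ w ↾ side ⊖ T₁
      le x with 0 <? z x | M x in eq | ≤-trans (z≼ x) (lower x)
      ... | no ¬p | _     | _ = ≤-trans (≮⇒≥ ¬p) z≤n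
      ... | yes _ | true  | p = p
      ... | yes px | false | _ with nbr
        where
        x₀x : adj G x₀ x ≡ true
        x₀x = cl x₀ x px₀ px λ { refl → true≢false x₀∈M eq }
        nbr = boundary x₀ x x₀∈M eq (<-≤-trans px (≤-trans (z≼ x) (⊖-≼ w T x))) x₀x
      -- `T₁` contains `m`, so it avoids the neighbour `x` of `m` and leaves the weight there
      -- unchanged.
      ... | vx , mx with T₁ x in x∈T₁
      ... | true  = ⊥-elim (true≢false mx (st₁ m x m∈T₁ x∈T₁))
      ... | false rewrite vx | mx = ≤-trans (z≼ x) (⊖-≼ w T x)

    hitting : Hitting r w
    hitting = T , stable , (v , v∈T , pos) , bound

  -- Both parts lose weight, since `v` is outside `side` and `m` is in `M`. So both can be coloured,
  -- and classes through `m` and `v` are picked for gluing.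
  hit-separated : ∀ {r w v m} → 0 < w v → 0 < w m → Separator w v m →
    (∀ w′ → w′ ≼ w → sum w′ < sum w → Col G (suc r) w′) → Hitting r w
  hit-separated {r} {w} {v} {m} pv pm sep colour = glue
    (col-through G r m m∈ (colour _ (↾-≼ w side) (sum-strict v (↾-≼ w side) v∉)))
    (col-through G r v v∈ (colour _ (∖-≼ w M) (sum-strict m (∖-≼ w M) m∉)))
    where
    open Separator sep
    m∈ : 0 < (w ↾ side) m
    m∈ rewrite m∈M = pm
    v∉ : (w ↾ side) v < w v
    v∉ rewrite v∉M | irrefl G v = pv
    v∈ : 0 < (w ∖ M) v
    v∈ rewrite v∉M = pv
    m∉ : (w ∖ M) m < w m
    m∉ rewrite m∈M = pm
    glue : (∃ λ T → T m ≡ true × Stable G T × Col G r (w ↾ side ⊖ T)) →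
      (∃ λ T → T v ≡ true × Stable G T × Col G r (w ∖ M ⊖ T)) → Hitting r w
    glue (_ , m∈T₁ , st₁ , c₁) (_ , v∈T₂ , st₂ , c₂) =
      Gluing.hitting pv sep m∈T₁ st₁ c₁ v∈T₂ st₂ c₂

  -- Induction on the total weight: a hitting set serves as a colour class, whose removal lowers the
  -- clique bound by one and the total weight strictly.
  perfect : ∀ fuel r {w} → sum w ≤ fuel → C5Free w → CliqueBound r w → Col G r w
  perfect fuel r {w} le c5free bound with supported? w
  ... | no none = col-mono G {r = 0} z≤n (λ v → ≮⇒≥ λ p → none (v , p))
  perfect zero r {w} le c5free bound | yes (v , pos) =
    ⊥-elim (<⇒≱ pos (≤-trans (term≤sum w v) le))
  -- With clique bound zero, the single vertex `v` is already too heavy a clique.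
  perfect (suc fuel) zero {w} le c5free bound | yes (v , pos) = ⊥-elim (<⇒≱ pos
    (≤-trans (≤-trans (≤-reflexive (≡.sym (mix-true {X = ⁅ v ⁆} {z = w} {w = const 0} (∈⁅⁆ v))))
      (term≤sum (w ↾ ⁅ v ⁆) v)) (bound (w ↾ ⁅ v ⁆) (↾-≼ w ⁅ v ⁆) single)))
    where
    single : Clique G (w ↾ ⁅ v ⁆)
    single x y px py x≢y with v ≟ x | v ≟ y
    ... | yes refl | yes refl = ⊥-elim (x≢y refl)
  perfect (suc fuel) (suc r) {w} le c5free bound | yes (v , pos) = finish hitting
    where
    colour : ∀ s w′ → w′ ≼ w → sum w′ < sum w → CliqueBound s w′ → Col G s w′
    colour s w′ w′≼w lt = perfect fuel s (≤-pred (<-≤-trans lt le))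
      λ a b c d e pa pb pc pd pe → c5free a b c d e
        (up pa) (up pb) (up pc) (up pd) (up pe)
      where
      up : ∀ {x} → 0 < w′ x → 0 < w x
      up {x} p = <-≤-trans p (w′≼w x)
    hitting : Hitting r w
    hitting with any? (λ u → (0 <? w u) ×-dec ¬? (u ≟ v) ×-dec (adj G v u Bool.≟ false))
    ... | no none = hit-universal v pos univ bound
      where
      univ : ∀ u → 0 < w u → u ≢ v → adj G v u ≡ true
      univ u pu u≢v with true? (adj G v u)
      ... | inj₁ vu = vu
      ... | inj₂ vu = ⊥-elim (none (u , pu , u≢v , vu))
    ... | yes far with separator c5free v pos far
    ... | m , pm , sep = hit-separated pos pm sep λ w′ w′≼w lt →
      colour (suc r) w′ w′≼w lt λ z z≼ → bound z (≼-trans z≼ w′≼w)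
    finish : Hitting r w → Col G (suc r) w
    finish (T , st , (t , t∈T , pt) , bound′) = T , st ,
      colour r (w ⊖ T) (⊖-≼ w T) (sum-strict t (⊖-≼ w T) strict) bound′
      where
      strict : (w ⊖ T) t < w t
      strict rewrite t∈T = ≤-reflexive (suc-pred (w t) {{>-nonZero pt}})

-- The bounding function

-- In closed form (5^k - 1) / 4. The factor 5 pays for the five twin classes, and the value 1 at 1
-- turns the bound for unit weights into one on the order.
F : ℕ → ℕ
F zero    = 0
F (suc k) = suc (5 * F k)

F-mono : ∀ {a b} → a ≤ b → F a ≤ F b
F-mono z≤n     = z≤n
F-mono (s≤s p) = s≤s (*-monoʳ-≤ 5 (F-mono p))

F-superadditive : ∀ a b → F a + F b ≤ F (a + b)
F-superadditive zero    b = ≤-refl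
F-superadditive (suc a) b = s≤s (begin
  5 * F a + F b     ≤⟨ +-monoʳ-≤ (5 * F a) (m≤n*m (F b) 5) ⟩
  5 * F a + 5 * F b ≡⟨ *-distribˡ-+ 5 (F a) (F b) ⟨
  5 * (F a + F b)   ≤⟨ *-monoʳ-≤ 5 (F-superadditive a b) ⟩
  5 * F (a + b)     ∎)
  where open ≤-Reasoning

sum-F : ∀ {n} (w : Fin n → ℕ) → sum (F ∘ w) ≤ F (sum w)
sum-F {zero}  w = z≤n
sum-F {suc n} w =
  ≤-trans (+-monoʳ-≤ (F (w zero)) (sum-F (w ∘ suc))) (F-superadditive (w zero) _)

sum-split : ∀ {n} (f : Fin n → ℕ) X → sum f ≤ sum (f ↾ X) + sum (f ∖ X)
sum-split f X = ≤-trans (sum-mono le) (≤-reflexive (∑-distrib-+ (f ↾ X) (f ∖ X)))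
  where
  le : f ≼ λ v → (f ↾ X) v + (f ∖ X) v
  le v with X v
  ... | true  = m≤m+n (f v) 0
  ... | false = ≤-refl

point : ∀ {n} → ℕ → Fin n → Fin n → ℕ
point y c = const y ↾ ⁅ c ⁆

point-at : ∀ {n} y (c : Fin n) → point y c c ≡ y
point-at y c rewrite ∈⁅⁆ c = refl

point-off : ∀ {n} y (c : Fin n) {v} → c ≢ v → point y c v ≡ 0
point-off y c {v} c≢v rewrite dec-false (c ≟ v) c≢v = refl

∖-off : ∀ {n} (w : Fin n → ℕ) {u v} → u ≢ v → (w ∖ ⁅ u ⁆) v ≡ w v
∖-off w {u} {v} u≢v rewrite dec-false (u ≟ v) u≢v = refl

-- Critical weightings and contraction of modules

module _ {n} (G : Graph n) where

  private
    V = Fin n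

  -- Weighted (k + 1)-criticality.
  Crit : ℕ → (V → ℕ) → Set
  Crit k w = Col G (suc k) w × ¬ Col G k w × (∀ u → 0 < w u → Col G k (w ∖ ⁅ u ⁆))

  -- Double negation avoids deciding `Col`. It is removed later, where the goal is an inequality
  -- between naturals.
  chromatic : ∀ k {w} → Col G k w → ¬ Col G 0 w → ¬ ¬ ∃ λ a → Col G (suc a) w × ¬ Col G a w
  chromatic zero    c ¬c₀ _  = ¬c₀ c
  chromatic (suc k) c ¬c₀ ¬χ = ¬χ (k , c , λ c′ → chromatic k c′ ¬c₀ ¬χ)

  ↾-pos : ∀ {w : V → ℕ} {X} v → 0 < (w ↾ X) v → X v ≡ true × 0 < w v
  ↾-pos {X = X} v p with X v
  ... | true = refl , p

  -- Take a `k`-colouring after deleting `u`. If more than `a` classes met `X`, a colouring of the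
  -- whole of `w ↾ X` could replace them, and `w` would be `k`-colourable.
  module-critical : ∀ {k a w X} → Crit k w → Module G X →
    Col G (suc a) (w ↾ X) → ¬ Col G a (w ↾ X) → Crit a (w ↾ X)
  module-critical {k} {a} {w} {X} (_ , ¬ck , crit) mod ca ¬ca = ca , ¬ca , without
    where
    without : ∀ u → 0 < (w ↾ X) u → Col G a (w ↾ X ∖ ⁅ u ⁆)
    without u pu = result
      where
      u∈X = proj₁ (↾-pos {w = w} {X} u pu)
      le : w ↾ X ∖ ⁅ u ⁆ ≼ (w ∖ ⁅ u ⁆) ↾ X
      le v with ⁅ u ⁆ v | X v
      ... | true  | true  = ≤-refl
      ... | true  | false = ≤-refl
      ... | false | true  = ≤-refl
      ... | false | false = ≤-refl
      le′ : w ≼ mix X (w ↾ X) (w ∖ ⁅ u ⁆)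
      le′ v with X v in eq
      ... | true  = ≤-refl
      ... | false = ≤-reflexive (≡.sym (∖-off w {u} λ { refl → true≢false u∈X eq }))
      result : Col G a (w ↾ X ∖ ⁅ u ⁆)
      result with recolour G mod k (crit u (proj₂ (↾-pos {w = w} {X} u pu)))
      ... | d , inX , swap with d ≤? a
      ... | yes d≤a = col-antitone G a le (col-mono G d≤a inX)
      ... | no  d≰a = ⊥-elim (¬ck (col-antitone G k le′ (swap (w ↾ X) (col-mono G (≰⇒> d≰a) ca))))

  module Merge {a w X c} (mod : Module G X) (c∈X : X c ≡ true)
    (ca : Col G (suc a) (w ↾ X)) (¬ca : ¬ Col G a (w ↾ X)) where

    merged : (V → ℕ) → V → ℕ
    merged = mix X (point (suc a) c)

    -- The colouring spends more than `a` classes on `X`, enough to host `c` with weight `suc a`.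
    raise : ∀ {w₀} r → (∀ v → X v ≡ true → w v ≤ w₀ v) → Col G r w₀ → Col G r (merged w₀)
    raise {w₀} r w≤w₀ col with recolour G mod r col
    ... | d , inX , swap with d ≤? a
    ... | yes d≤a = ⊥-elim (¬ca (col-antitone G a le (col-mono G d≤a inX)))
      where
      le : w ↾ X ≼ w₀ ↾ X
      le v with X v in eq
      ... | true  = w≤w₀ v eq
      ... | false = z≤n
    ... | no  d≰a = swap _ (col-mono G (≰⇒> d≰a) (col-point G (suc a) c))

    -- The weight of `c` forces at least `suc a` classes to meet `X`, enough to recolour `w ↾ X` in
    -- them.
    lower : ∀ r → Col G r (merged w) → Col G r w
    lower r col with recolour G mod r col
    ... | d , inX , swap = col-antitone G r le (swap (w ↾ X) (col-mono G a<d ca))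
      where
      at-c : (merged w ↾ X) c ≡ suc a
      at-c rewrite c∈X = point-at (suc a) c
      a<d : suc a ≤ d
      a<d = ≤-trans (≤-reflexive (≡.sym at-c)) (col-weight G d c inX)
      le : w ≼ mix X (w ↾ X) (merged w)
      le v with X v
      ... | true  = ≤-refl
      ... | false = ≤-refl

    critical : ∀ {k} → 0 < w c → Crit k w → Crit k (merged w)
    critical {k} pc (cw , ¬cw , crit) = raise (suc k) (λ _ _ → ≤-refl) cw , ¬cw ∘ lower k , without
      where
      without : ∀ u → 0 < merged w u → Col G k (merged w ∖ ⁅ u ⁆)
      without u pu with X u in u∈
      ... | false = col-antitone G k le (raise k unchanged (crit u pu))
        where
        unchanged : ∀ v → X v ≡ true → w v ≤ (w ∖ ⁅ u ⁆) v
        unchanged v v∈ = ≤-reflexive (≡.sym (∖-off w {u} λ { refl → true≢false v∈ u∈ }))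
        le : merged w ∖ ⁅ u ⁆ ≼ merged (w ∖ ⁅ u ⁆)
        le v with ⁅ u ⁆ v | X v
        ... | true  | _     = z≤n
        ... | false | true  = ≤-refl
        ... | false | false = ≤-refl
      -- Inside `X` only `c` carries merged weight. Once it is deleted nothing is left on `X`, so
      -- the deletion of `c` from `w` dominates.
      ... | true = col-antitone G k le (crit c pc)
        where
        u≡c : c ≡ u
        u≡c = decidable-stable (c ≟ u) λ c≢u → <⇒≢ pu (≡.sym (point-off (suc a) c c≢u))
        le : merged w ∖ ⁅ u ⁆ ≼ w ∖ ⁅ c ⁆
        le v rewrite ≡.sym u≡c with c ≟ v
        ... | yes _ = ≤-refl
        ... | no _ with X v
        ... | true  = z≤n
        ... | false = ≤-refl

    -- The whole contribution of `X` is charged to the new weight of `c`.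
    sum-merged : sum (F ∘ (w ↾ X)) ≤ F (suc a) → sum (F ∘ w) ≤ sum (F ∘ merged w)
    sum-merged part = begin
      sum (F ∘ w)                                           ≤⟨ sum-split (F ∘ w) X ⟩
      sum ((F ∘ w) ↾ X) + sum ((F ∘ w) ∖ X)                 ≤⟨ +-monoˡ-≤ _ (≤-trans (sum-mono inside) part) ⟩
      F (suc a) + sum ((F ∘ w) ∖ X)                         ≡⟨ cong (_+ _) (point-at (F (suc a)) c) ⟨
      point (F (suc a)) c c + sum ((F ∘ w) ∖ X)             ≤⟨ +-monoˡ-≤ _ (term≤sum (point (F (suc a)) c) c) ⟩
      sum (point (F (suc a)) c) + sum ((F ∘ w) ∖ X)         ≡⟨ ∑-distrib-+ (point (F (suc a)) c) ((F ∘ w) ∖ X) ⟨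
      sum (λ v → point (F (suc a)) c v + ((F ∘ w) ∖ X) v)   ≤⟨ sum-mono le ⟩
      sum (F ∘ merged w)                                    ∎
      where
      open ≤-Reasoning
      inside : (F ∘ w) ↾ X ≼ F ∘ (w ↾ X)
      inside v with X v
      ... | true  = ≤-refl
      ... | false = z≤n
      le : (λ v → point (F (suc a)) c v + ((F ∘ w) ∖ X) v) ≼ F ∘ merged w
      le v with X v in eq | c ≟ v
      ... | true  | yes refl = ≤-reflexive (+-identityʳ _)
      ... | true  | no _     = z≤n
      ... | false | no _     = ≤-refl
      ... | false | yes refl = ⊥-elim (true≢false c∈X eq)

-- The bound for critical weightings, by induction on k

sign : ℕ → ℕ
sign zero    = 0
sign (suc _) = 1

module _ {n} (G : Graph n) (free : P5coP5Free G) where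

  private
    V = Fin n

    Bound : ℕ → Set
    Bound k = ∀ w → Crit G k w → sum (F ∘ w) ≤ F (suc k)

  -- `X` misses the support vertex `u`, so it is `k`-colourable; being critical with a smaller
  -- index, it falls under the induction hypothesis.
  proper-part : ∀ {k w X} → (∀ a → a < k → Bound a) → Crit G k w → Module G X →
    ∀ {x u} → X x ≡ true → 0 < w x → X u ≡ false → 0 < w u →
    ¬ ¬ ∃ λ a → Col G (suc a) (w ↾ X) × ¬ Col G a (w ↾ X) × a < k × sum (F ∘ (w ↾ X)) ≤ F (suc a)
  proper-part {k} {w} {X} smaller crit@(_ , _ , without) mod {x} {u} x∈ px u∉ pu ¬part =
    chromatic G k colk ¬c₀ λ { (a , ca , ¬ca) →
      let a<k = ≰⇒> (λ k≤a → ¬ca (col-mono G k≤a colk)) in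
      ¬part (a , ca , ¬ca , a<k , smaller a a<k (w ↾ X) (module-critical G crit mod ca ¬ca)) }
    where
    le : w ↾ X ≼ w ∖ ⁅ u ⁆
    le v with X v in eq
    ... | true  = ≤-reflexive (≡.sym (∖-off w {u} λ { refl → true≢false eq u∉ }))
    ... | false = z≤n
    colk : Col G k (w ↾ X)
    colk = col-antitone G k le (without u pu)
    ¬c₀ : ¬ Col G 0 (w ↾ X)
    ¬c₀ c = <⇒≱ px (≤-trans (≤-reflexive (≡.sym (mix-true {X = X} {z = w} {w = const 0} x∈))) (c x))

  -- `c` misses `e`, unlike a twin of `a`. This provides the support vertex outside the twin class.
  not-twin : ∀ {a b c d e} → C5 G a b c d e → twins G free b c d e c ≡ false
  not-twin {b = b} {c} h rewrite adj-flip G b c (C5.bc h) | C5.ce h = refl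

  -- Each twin class is a module missing part of the support, so it contributes at most `F k`.
  -- Overlaps would be harmless for an upper bound.
  five-parts : ∀ {k w a b c d e} → (∀ j → j < k → Bound j) → Crit G k w → C5 G a b c d e →
    0 < w a → 0 < w b → 0 < w c → 0 < w d → 0 < w e →
    (∀ v → 0 < w v → hull G free a b c d e v ≡ true) → sum (F ∘ w) ≤ F (suc k)
  five-parts {k} {w} {a} {b} {c} {d} {e} smaller crit h pa pb pc pd pe cover = begin
    sum (F ∘ w)                                             ≤⟨ sum-mono le ⟩
    sum (λ v → f₀ v + (f₁ v + (f₂ v + (f₃ v + f₄ v))))      ≡⟨ split ⟩
    sum f₀ + (sum f₁ + (sum f₂ + (sum f₃ + sum f₄)))        ≤⟨ +-mono-≤ s₀ (+-mono-≤ s₁ (+-mono-≤ s₂ (+-mono-≤ s₃ s₄))) ⟩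
    F k + (F k + (F k + (F k + F k)))                       ≡⟨ cong (λ y → F k + (F k + (F k + (F k + y)))) (+-identityʳ (F k)) ⟨
    5 * F k                                                 ≤⟨ n≤1+n _ ⟩
    F (suc k)                                               ∎
    where
    open ≤-Reasoning
    h₁ = rotate G h
    h₂ = rotate G h₁
    h₃ = rotate G h₂
    h₄ = rotate G h₃
    X₀ = twins G free b c d e
    X₁ = twins G free c d e a
    X₂ = twins G free d e a b
    X₃ = twins G free e a b c
    X₄ = twins G free a b c d
    f₀ = F ∘ (w ↾ X₀)
    f₁ = F ∘ (w ↾ X₁)
    f₂ = F ∘ (w ↾ X₂)
    f₃ = F ∘ (w ↾ X₃)
    f₄ = F ∘ (w ↾ X₄)
    part : ∀ {a b c d e} → C5 G a b c d e → 0 < w a → 0 < w c →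
      sum (F ∘ (w ↾ twins G free b c d e)) ≤ F k
    part h pa pc = decidable-stable (_ ≤? _) λ big →
      proper-part smaller crit (twins-module G free h) (self-twin G free h) pa (not-twin h) pc
        λ { (_ , _ , _ , a<k , le) → big (≤-trans le (F-mono a<k)) }
    s₀ = part h pa pc
    s₁ = part h₁ pb pd
    s₂ = part h₂ pc pe
    s₃ = part h₃ pd pa
    s₄ = part h₄ pe pb
    split : sum (λ v → f₀ v + (f₁ v + (f₂ v + (f₃ v + f₄ v)))) ≡
      sum f₀ + (sum f₁ + (sum f₂ + (sum f₃ + sum f₄)))
    split = ≡.trans (∑-distrib-+ f₀ _) (cong (sum f₀ +_)
      (≡.trans (∑-distrib-+ f₁ _) (cong (sum f₁ +_)
      (≡.trans (∑-distrib-+ f₂ _) (cong (sum f₂ +_) (∑-distrib-+ f₃ f₄))))))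
    member : ∀ {X v} → X v ≡ true → F (w v) ≤ F ((w ↾ X) v)
    member p rewrite p = ≤-refl
    le : F ∘ w ≼ λ v → f₀ v + (f₁ v + (f₂ v + (f₃ v + f₄ v)))
    le v with 0 <? w v
    ... | no ¬p = ≤-trans (F-mono (≮⇒≥ ¬p)) z≤n
    ... | yes p with hull-split G free {a} {b} {c} {d} {e} v (cover v p)
    ... | inj₁ t = ≤-trans (member {X₀} t) (m≤m+n _ _)
    ... | inj₂ (inj₁ t) = ≤-trans (member {X₁} t) (≤-trans (m≤m+n _ _) (m≤n+m _ (f₀ v)))
    ... | inj₂ (inj₂ (inj₁ t)) = ≤-trans (member {X₂} t)
      (≤-trans (m≤m+n _ _) (≤-trans (m≤n+m _ (f₁ v)) (m≤n+m _ (f₀ v))))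
    ... | inj₂ (inj₂ (inj₂ (inj₁ t))) = ≤-trans (member {X₃} t)
      (≤-trans (m≤m+n _ _) (≤-trans (m≤n+m _ (f₂ v)) (≤-trans (m≤n+m _ (f₁ v)) (m≤n+m _ (f₀ v)))))
    ... | inj₂ (inj₂ (inj₂ (inj₂ t))) = ≤-trans (member {X₄} t)
      (≤-trans (m≤n+m _ (f₃ v)) (≤-trans (m≤n+m _ (f₂ v)) (≤-trans (m≤n+m _ (f₁ v)) (m≤n+m _ (f₀ v)))))

  -- By `perfect`, some clique is heavier than `k`. It must use the whole support, since it would
  -- otherwise survive a deletion that leaves a `k`-colourable weighting. So `w` itself is a clique
  -- of weight at most `suc k`, and `sum-F` applies.
  clique-case : ∀ {k w} → Crit G k w → C5Free G free w → sum (F ∘ w) ≤ F (suc k)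
  clique-case {k} {w} (cw , ¬cw , without) c5free = decidable-stable (_ ≤? _) λ big →
    ¬cw (perfect G free (sum w) k ≤-refl c5free (bound big))
    where
    bound : ¬ sum (F ∘ w) ≤ F (suc k) → CliqueBound G free k w
    bound big z z≼w cl = decidable-stable (sum z ≤? k) λ heavy →
      let supp : ∀ u → 0 < w u → 0 < z u
          supp u pu = decidable-stable (0 <? z u) λ ¬p → heavy
            (clique-bound G k (without u pu) (avoid u ¬p) cl)
      in big (≤-trans (sum-F w) (F-mono (clique-bound G (suc k) cw ≼-refl
           λ u v pu pv → cl u v (supp u pu) (supp v pv))))
      where
      avoid : ∀ u → ¬ 0 < z u → z ≼ w ∖ ⁅ u ⁆
      avoid u ¬p v with u ≟ v
      ... | yes refl = ≮⇒≥ ¬p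
      ... | no _     = z≼w v

  -- The fuel bounds the size of the support, which shrinks whenever the hull of a C5 is contracted
  -- to `a`.
  bound-step : ∀ {k} → (∀ a → a < k → Bound a) → ∀ fuel w → sum (sign ∘ w) ≤ fuel →
    Crit G k w → sum (F ∘ w) ≤ F (suc k)
  bound-step {k} smaller fuel w le crit = decidable-stable (_ ≤? _) λ big →
    big (clique-case crit λ a b c d e pa pb pc pd pe h → has-C5 big h pa pb pc pd pe)
    where
    has-C5 : ¬ sum (F ∘ w) ≤ F (suc k) → ∀ {a b c d e} → C5 G a b c d e →
      0 < w a → 0 < w b → 0 < w c → 0 < w d → 0 < w e → ⊥
    has-C5 big {a} {b} {c} {d} {e} h pa pb pc pd pe
      with any? (λ u → (0 <? w u) ×-dec (hull G free a b c d e u Bool.≟ false))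
    ... | no none = big (five-parts smaller crit h pa pb pc pd pe cover)
      where
      cover : ∀ v → 0 < w v → hull G free a b c d e v ≡ true
      cover v p with true? (hull G free a b c d e v)
      ... | inj₁ q = q
      ... | inj₂ q = ⊥-elim (none (v , p , q))
    ... | yes (u , pu , u∉) =
      proper-part smaller crit mod a∈ pa u∉ pu λ { (α , cα , ¬cα , _ , part) →
        big (≤-trans (Merge.sum-merged G mod a∈ cα ¬cα part)
          (recurse (Merge.merged G mod a∈ cα ¬cα w)
            (fewer cα ¬cα)
            (Merge.critical G mod a∈ cα ¬cα pa crit))) }
      where
      X = hull G free a b c d e
      mod = hull-module G free h
      a∈ : X a ≡ true
      a∈ rewrite self-twin G free h = refl
      b∈ : X b ≡ true
      b∈ rewrite self-twin G free (rotate G h) = ∨-joinʳ (twins G free b c d e b) refl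
      a≢b : a ≢ b
      a≢b refl = true≢false (C5.ab h) (irrefl G a)
      recurse : ∀ w′ → sum (sign ∘ w′) < sum (sign ∘ w) → Crit G k w′ → sum (F ∘ w′) ≤ F (suc k)
      recurse w′ lt = go fuel le
        where
        go : ∀ fuel → sum (sign ∘ w) ≤ fuel → Crit G k w′ → sum (F ∘ w′) ≤ F (suc k)
        go zero       le = ⊥-elim (<⇒≱ lt (≤-trans le z≤n))
        go (suc fuel) le = bound-step smaller fuel w′ (≤-pred (<-≤-trans lt le))
      fewer : ∀ {α} (cα : Col G (suc α) (w ↾ X)) (¬cα : ¬ Col G α (w ↾ X)) →
        sum (sign ∘ Merge.merged G mod a∈ cα ¬cα w) < sum (sign ∘ w)
      -- `b` is in the hull and differs from `a`, so it leaves the support.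
      fewer {α} cα ¬cα = sum-strict b pointwise strict
        where
        sign-pos : ∀ {m} → 0 < m → 1 ≤ sign m
        sign-pos (s≤s _) = s≤s z≤n
        pointwise : sign ∘ Merge.merged G mod a∈ cα ¬cα w ≼ sign ∘ w
        pointwise v with X v | a ≟ v
        ... | false | _        = ≤-refl
        ... | true  | no _     = z≤n
        ... | true  | yes refl = sign-pos pa
        strict : sign (Merge.merged G mod a∈ cα ¬cα w b) < sign (w b)
        strict rewrite b∈ | point-off (suc α) a a≢b = sign-pos pb

  critical-bound : ∀ k → Bound k
  critical-bound k = below (suc k) k ≤-refl
    where
    below : ∀ m a → a < m → Bound a
    below (suc m) a (s≤s a≤m) w =
      bound-step (λ b b<a → below m b (<-≤-trans b<a a≤m)) (sum (sign ∘ w)) w ≤-refl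

-- From ordinary colourings and critical graphs to unit weights

one : ∀ {n} → Fin n → ℕ
one = const 1

module _ {n} (G : Graph n) where

  colouring⇒Col : ∀ k (X : Fin n → Bool) (c : Fin n → ℕ) → (∀ v → X v ≡ true → c v < k) →
    (∀ u v → X u ≡ true → X v ≡ true → adj G u v ≡ true → c u ≢ c v) → Col G k (one ↾ X)
  colouring⇒Col zero X c c<k proper v with X v in eq
  ... | true  = ⊥-elim (<⇒≱ (c<k v eq) z≤n)
  ... | false = z≤n
  colouring⇒Col (suc k) X c c<k proper = T , stable ,
    col-antitone G k le (colouring⇒Col k X′ c c<k′ λ u v p q → proper u v (∧-splitˡ p) (∧-splitˡ q))
    where
    isLast : Fin n → Bool
    isLast v = does (c v ≟ℕ k)
    last-colour : ∀ v → isLast v ≡ true → c v ≡ k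
    last-colour v p = decidable-stable (c v ≟ℕ k) λ ≢k → true≢false p (dec-false (c v ≟ℕ k) ≢k)
    T X′ : Fin n → Bool
    T v = X v ∧ isLast v
    X′ v = X v ∧ not (isLast v)
    stable : Stable G T
    stable u v p q with true? (adj G u v)
    ... | inj₂ uv = uv
    ... | inj₁ uv = ⊥-elim (proper u v (∧-splitˡ p) (∧-splitˡ q) uv
      (≡.trans (last-colour u (∧-splitʳ {X u} p)) (≡.sym (last-colour v (∧-splitʳ {X v} q)))))
    c<k′ : ∀ v → X′ v ≡ true → c v < k
    c<k′ v p = ≤∧≢⇒< (≤-pred (c<k v (∧-splitˡ p))) λ ≡k →
      true≢false (∧-splitʳ {X v} p) (cong not (dec-true (c v ≟ℕ k) ≡k))
    le : one ↾ X ⊖ T ≼ one ↾ X′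
    le v with X v | isLast v
    ... | true  | true  = z≤n
    ... | true  | false = ≤-refl
    ... | false | _     = z≤n

  Col⇒colouring : ∀ r {w} → Col G r w → ∃ λ (c : Fin n → ℕ) → (∀ v → 0 < w v → c v < r) ×
    (∀ u v → 0 < w u → 0 < w v → adj G u v ≡ true → c u ≢ c v)
  Col⇒colouring zero    none = const 0 , (λ v p → ⊥-elim (<⇒≱ p (none v))) ,
    λ u v p → ⊥-elim (<⇒≱ p (none u))
  Col⇒colouring (suc r) {w} (T , st , col) with Col⇒colouring r col
  -- A vertex in several classes takes the colour of the outermost one.
  ... | c , c<r , proper = mix T (const r) c , bounded , proper′
    where
    rest : ∀ v → T v ≡ false → 0 < w v → 0 < (w ⊖ T) v
    rest v v∉T p rewrite v∉T = p
    bounded : ∀ v → 0 < w v → mix T (const r) c v < suc r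
    bounded v p with T v in eq
    ... | true  = ≤-refl
    ... | false = m≤n⇒m≤1+n (c<r v (rest v eq p))
    proper′ : ∀ u v → 0 < w u → 0 < w v → adj G u v ≡ true →
      mix T (const r) c u ≢ mix T (const r) c v
    proper′ u v p q uv with T u in equ | T v in eqv
    ... | true  | true  = λ _ → true≢false uv (st u v equ eqv)
    ... | true  | false = λ eq → <⇒≢ (c<r v (rest v eqv q)) (≡.sym eq)
    ... | false | true  = <⇒≢ (c<r u (rest u equ p))
    ... | false | false = proper u v (rest u equ p) (rest v eqv q) uv

  Colorable⇒Col : ∀ k → Colorable G k → Col G k one
  Colorable⇒Col k (c , proper) = colouring⇒Col k (const true) (toℕ ∘ c)
    (λ v _ → toℕ<n (c v)) (λ u v _ _ uv eq → proper u v uv (toℕ-injective eq))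

  Col⇒Colorable : ∀ k → Col G k one → Colorable G k
  Col⇒Colorable k col with Col⇒colouring k col
  ... | c , c<k , proper = (λ v → fromℕ< (c<k v (s≤s z≤n))) , λ u v uv eq →
    proper u v (s≤s z≤n) (s≤s z≤n) uv
      (≡.trans (≡.sym (toℕ-fromℕ< _)) (≡.trans (cong toℕ eq) (toℕ-fromℕ< _)))

punchOut-cover : ∀ {n} (u : Fin (suc n)) v → (u ≡ v) ⊎ (∃ λ j → punchIn u j ≡ v)
punchOut-cover u v with u ≟ v
... | yes u≡v = inj₁ u≡v
... | no  u≢v = inj₂ (punchOut u≢v , punchIn-punchOut u≢v)

delete-vertex : ∀ {n} (G : Graph (suc n)) k u → Colorable (induced G (punchIn u)) k →
  Col G k (one ∖ ⁅ u ⁆)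
delete-vertex {n} G k u (c , proper) = col-antitone G k le
  (colouring⇒Col G k others colour bounded proper′)
  where
  others : Fin (suc n) → Bool
  others v = not (⁅ u ⁆ v)
  colour : Fin (suc n) → ℕ
  colour v with punchOut-cover u v
  -- A default at `u`, which `others` excludes.
  ... | inj₁ _       = 0
  ... | inj₂ (j , _) = toℕ (c j)
  le : one ∖ ⁅ u ⁆ ≼ one ↾ others
  le v with ⁅ u ⁆ v
  ... | true  = z≤n
  ... | false = ≤-refl
  not-u : ∀ {v} → others v ≡ true → u ≢ v
  not-u {v} p u≡v = true≢false p (cong not (dec-true (u ≟ v) u≡v))
  bounded : ∀ v → others v ≡ true → colour v < k
  bounded v p with punchOut-cover u v
  ... | inj₁ u≡v     = ⊥-elim (not-u p u≡v)
  ... | inj₂ (j , _) = toℕ<n (c j)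
  proper′ : ∀ x y → others x ≡ true → others y ≡ true → adj G x y ≡ true → colour x ≢ colour y
  proper′ x y p q xy with punchOut-cover u x | punchOut-cover u y
  ... | inj₁ u≡x | _        = ⊥-elim (not-u p u≡x)
  ... | inj₂ _   | inj₁ u≡y = ⊥-elim (not-u q u≡y)
  ... | inj₂ (i , refl) | inj₂ (j , refl) = proper i j xy ∘ toℕ-injective

Critical⇒Crit : ∀ {n} (G : Graph n) k → Critical (suc k) G → Crit G k one
Critical⇒Crit {n} G k ((col , ¬col) , delete) =
  Colorable⇒Col G (suc k) col , ¬col k ≤-refl ∘ Col⇒Colorable G k , without G delete
  where
  without : ∀ {n} (G : Graph n) →
    (∀ m (f : Fin m → Fin n) → (∀ {x y} → f x ≡ f y → x ≡ y) → m < n → Colorable (induced G f) k) →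
    ∀ u → 0 < one u → Col G k (one ∖ ⁅ u ⁆)
  -- The vertex `u` shows that the order is a successor, so `punchIn u` embeds the graph without
  -- `u`.
  without {suc n} G delete u _ =
    delete-vertex G k u (delete n (punchIn u) (punchIn-injective u _ _) ≤-refl)

critical-order : ∀ k {n} (G : Graph n) → Critical (suc k) G → P5coP5Free G → n ≤ F (suc k)
critical-order k {n} G crit free =
  ≤-trans (≤-reflexive (≡.sym (sum-one n))) (critical-bound G free k one (Critical⇒Crit G k crit))
  where
  sum-one : ∀ n → sum {n} (F ∘ one) ≡ n
  sum-one zero    = refl
  sum-one (suc n) = cong suc (sum-one n)

-- Enumeration of the graphs of bounded order

functions : ∀ {A : Set} → List A → ∀ n → List (Fin n → A)
functions as zero    = (λ ()) ∷ []
functions as (suc n) =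
  concatMap (λ a → map (λ f → λ { zero → a ; (suc i) → f i }) (functions as n)) as

-- The list is complete only up to pointwise R, as functions are not extensional.
functions-complete : ∀ {A : Set} (R : A → A → Set) {as} → (∀ a → Any (R a) as) →
  ∀ n (f : Fin n → A) → Any (λ g → ∀ i → R (f i) (g i)) (functions as n)
functions-complete R complete zero    f = here λ ()
functions-complete R complete (suc n) f = concatMap⁺ _ (Any.map
  (λ r₀ → map⁺ (Any.map (λ r → λ { zero → r₀ ; (suc i) → r i })
    (functions-complete R complete n (f ∘ suc))))
  (complete (f zero)))

matrices : ∀ n → List (Fin n → Fin n → Bool)
matrices n = functions (functions (true ∷ false ∷ []) n) n

matrices-complete : ∀ n (a : Fin n → Fin n → Bool) →
  Any (λ b → ∀ i j → a i j ≡ b i j) (matrices n)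
matrices-complete n = functions-complete (λ f g → ∀ j → f j ≡ g j)
  (functions-complete _≡_ (λ { true → here refl ; false → there (here refl) }) n) n

-- Forced symmetry and a cleared diagonal make a graph of every matrix, so all matrices can be
-- listed; adjacency matrices are unchanged.
fromMatrix : ∀ {n} → (Fin n → Fin n → Bool) → Graph n
fromMatrix a = record
  { adj    = λ i j → not (does (i ≟ j)) ∧ (a i j ∧ a j i)
  ; sym    = λ i j → ≡.cong₂ _∧_ (cong not (≟-comm i j)) (∧-comm (a i j) (a j i))
  ; irrefl = λ i → cong (λ b → not b ∧ (a i i ∧ a i i)) (dec-true (i ≟ i) refl) }
  where
  ≟-comm : ∀ i j → does (i ≟ j) ≡ does (j ≟ i)
  ≟-comm i j with i ≟ j
  ... | yes i≡j = ≡.sym (dec-true (j ≟ i) (≡.sym i≡j))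
  ... | no  i≢j = ≡.sym (dec-false (j ≟ i) (i≢j ∘ ≡.sym))

fromMatrix-≅ : ∀ {n} (G : Graph n) a → (∀ i j → adj G i j ≡ a i j) → G ≅ fromMatrix a
fromMatrix-≅ G a same = record { bij = ↔-id _ ; preserves = pres }
  where
  pres : ∀ i j → adj G i j ≡ adj (fromMatrix a) i j
  pres i j with i ≟ j
  ... | yes refl = irrefl G i
  ... | no _ rewrite ≡.sym (same i j) | ≡.sym (same j i) | Graph.sym G j i with adj G i j
  ... | true  = refl
  ... | false = refl

graphsOfOrder : ℕ → List (Σ ℕ Graph)
graphsOfOrder n = map (λ a → n , fromMatrix a) (matrices n)

graphsOfOrder-complete : ∀ {n} (G : Graph n) → Any (λ H → G ≅ proj₂ H) (graphsOfOrder n)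
graphsOfOrder-complete {n} G =
  map⁺ (Any.map (λ {a} → fromMatrix-≅ G a) (matrices-complete n (adj G)))

graphs-complete : ∀ N {n} (G : Graph n) → n ≤ N →
  Any (λ H → G ≅ proj₂ H) (concatMap graphsOfOrder (upTo (suc N)))
graphs-complete N G n≤N = concatMap⁺ graphsOfOrder
  (Any.map (λ { refl → graphsOfOrder-complete G }) (∈-upTo⁺ (s≤s n≤N)))

theorem2 : (k : ℕ) → 1 ≤ k →
    Σ (List (Σ ℕ Graph)) λ L →
    ∀ n (G : Graph n) → Critical k G → P5coP5Free G →
    Any (λ H → G ≅ proj₂ H) L
-- All graphs of order at most `F (suc k)` are listed, critical or not. `upTo` excludes its
-- argument, hence the outer successor.
theorem2 (suc k) _ = concatMap graphsOfOrder (upTo (suc (F (suc k)))) , λ n G crit free →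
  graphs-complete (F (suc k)) G (critical-order k G crit free)
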